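{- For any $u \in A^*$, the Baxter $\mathsf{P}$-symbol of $u$ and the iterative Baxter $\mathsf{P}$-symbol of $u$ are equal.
   Context: $A = \{a_1 < a_2 < \cdots\}$ is a totally ordered infinite alphabet and $A^*$ is the free monoid of words on $A$. A binary tree is either empty (a leaf) or a node with a left and a right binary subtree. A tree with nodes labeled by $A$ is a right (resp. left) binary search tree if for every node labeled by $b$, every label $a$ in its left subtree and every label $c$ in its right subtree, one has $a \leq b < c$ (resp. $a < b \leq c$). Leaf insertion of a letter $a$ into a right (resp. left) binary search tree $T$: if $T$ is empty, return the one-node tree labeled $a$; otherwise, with $b$ the label of the root, if $a \leq b$ (resp. $a<b$) recursively leaf insert $a$ into the left subtree, otherwise into the right subtree. Baxter $\mathsf{P}$-symbol of $u$: the pair $(T_L,T_R)$ where $T_L$ (resp. $T_R$) is the left (resp. right) binary search tree obtained by leaf inserting the letters of $u$ from left to right (resp. right to left), starting from the empty tree. Root insertion: for a right binary search tree $T$ and a letter $b$, $T_{\leq b}$ is the right binary search tree made exactly of the nodes of $T$ labeled by letters $a \leq b$, and such that for all nodes $x, y$ of $T_{\leq b}$, if $x$ is an ancestor of $y$ in $T_{\leq b}$ then $x$ is an ancestor of $y$ in $T$; $T_{> b}$ is defined in the same way with the nodes labeled by letters $> b$. The root insertion of a letter $a$ into $T$ produces the tree whose root is a new node labeled by $a$, with left subtree $T_{\leq a}$ and right subtree $T_{> a}$. Iterative Baxter $\mathsf{P}$-symbol of $u$: the pair obtained from the pair of empty trees by inserting successively the letters of $u$ from left to right, where the insertion of a letter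 $a$ into $(T_L,T_R)$ consists in making a leaf insertion of $a$ into the left binary search tree $T_L$ and a root insertion of $a$ into the right binary search tree $T_R$. -}

module Defs where

open import Data.List.Base using (List; []; _∷_; foldl; foldr)
open import Data.Nat.Base using (ℕ; _≤_; _<_; _>_)
open import Data.Nat.Properties using (_≤?_; _<?_)
open import Data.Product.Base using (_×_; _,_; ∃-syntax)
open import Data.Tree.Binary using (Tree; leaf; node)
open import Data.Unit.Base using (⊤; tt)
open import Function.Definitions using (Injective)
open import Relation.Binary.PropositionalEquality.Core using (_≡_)
open import Relation.Nullary.Decidable.Core using (yes; no)

-- The alphabet a₁ < a₂ < ⋯ has order type ω: the number i stands for the
-- letter aᵢ₊₁, with the usual order on ℕ.
Letter : Set
Letter = ℕ

Word : Set
Word = List Letter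

-- The leaves of the library's trees are the empty trees; they carry no data.
BinTree : Set
BinTree = Tree Letter ⊤

pattern empty = leaf tt

-- Nodes are positions, so distinct nodes may have the same label.
data Node : BinTree → Set where
  root    : ∀ {l b r} → Node (node l b r)
  inLeft  : ∀ {l b r} → Node l → Node (node l b r)
  inRight : ∀ {l b r} → Node r → Node (node l b r)

label : ∀ {t} → Node t → Letter
label {node _ b _} root        = b
label {node _ _ _} (inLeft x)  = label x
label {node _ _ _} (inRight x) = label x

-- Proper ancestors: no node is an ancestor of itself.
data _IsAncestorOf_ : ∀ {t} → Node t → Node t → Set where
  root-left  : ∀ {l b r} {y : Node l} →
               root {l} {b} {r} IsAncestorOf inLeft y
  root-right : ∀ {l b r} {y : Node r} →
               root {l} {b} {r} IsAncestorOf inRight y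
  inLeft     : ∀ {l b r} {x y : Node l} → x IsAncestorOf y →
               inLeft {l} {b} {r} x IsAncestorOf inLeft y
  inRight    : ∀ {l b r} {x y : Node r} → x IsAncestorOf y →
               inRight {l} {b} {r} x IsAncestorOf inRight y

data IsRightBST : BinTree → Set where
  leaf : IsRightBST empty
  node : ∀ {l b r} →
         (∀ (x : Node l) → label x ≤ b) →
         (∀ (y : Node r) → b < label y) →
         IsRightBST l → IsRightBST r → IsRightBST (node l b r)

leafInsertLeft : Letter → BinTree → BinTree
leafInsertLeft a empty = node empty a empty
leafInsertLeft a (node l b r) with a <? b
... | yes _ = node (leafInsertLeft a l) b r
... | no  _ = node l b (leafInsertLeft a r)

leafInsertRight : Letter → BinTree → BinTree
leafInsertRight a empty = node empty a empty
leafInsertRight a (node l b r) with a ≤? b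
... | yes _ = node (leafInsertRight a l) b r
... | no  _ = node l b (leafInsertRight a r)

-- foldl reads the word from left to right, foldr from right to left.
baxterP : Word → BinTree × BinTree
baxterP u = foldl (λ t a → leafInsertLeft a t) empty u ,
            foldr leafInsertRight empty u

-- s is a right binary search tree made exactly of the nodes of t whose label
-- satisfies P, every ancestor relation of s being already present in t.
-- The map origin identifies the nodes of s with those nodes of t.
record IsRestriction (P : Letter → Set) (t s : BinTree) : Set where
  field
    isRightBST      : IsRightBST s
    origin          : Node s → Node t
    origin-inj      : Injective _≡_ _≡_ origin
    origin-label    : ∀ x → label (origin x) ≡ label x
    origin-sound    : ∀ x → P (label (origin x))
    origin-complete : ∀ y → P (label y) → ∃[ x ] origin x ≡ y
    origin-ancestor : ∀ {x y} → x IsAncestorOf y →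
                      origin x IsAncestorOf origin y

-- T≤a and T>a are given by their defining properties, which makes root
-- insertion, and the iterative symbol below, relations rather than functions.
data RootInsert (a : Letter) (t : BinTree) : BinTree → Set where
  rootInsert : ∀ {t≤a t>a} →
               IsRestriction (_≤ a) t t≤a → IsRestriction (_> a) t t>a →
               RootInsert a t (node t≤a a t>a)

data Insert (a : Letter) : BinTree × BinTree → BinTree × BinTree → Set where
  insert : ∀ {tL tR tR′} → RootInsert a tR tR′ →
           Insert a (tL , tR) (leafInsertLeft a tL , tR′)

data InsertWord : Word → BinTree × BinTree → BinTree × BinTree → Set where
  []  : ∀ {p} → InsertWord [] p p
  _∷_ : ∀ {a u p q r} → Insert a p q → InsertWord u q r →
        InsertWord (a ∷ u) p r

IsIterativeBaxterP : Word → BinTree × BinTree → Set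
IsIterativeBaxterP u p = InsertWord u (empty , empty) p

{-# OPTIONS --safe #-}

-- Leaf insertion of c commutes with root insertion of a, because splitting a
-- tree at a commutes with leaf insertion. Hence root inserting the letters of
-- u from left to right agrees with leaf inserting them from right to left.
-- The defining properties of T≤a and T>a determine these trees: if the root of
-- T is kept, it must be the root of the restriction, and the search tree order
-- separates the other nodes; if not, one subtree of T contributes no node.

module Submission where

open import Data.Empty using (⊥-elim)
open import Data.List.Base using ([]; _∷_; foldl; foldr)
open import Data.Nat.Base using (_≤_; _<_; _>_)
open import Data.Nat.Properties using (_≤?_; ≤-trans; <⇒≤; <⇒≱; ≰⇒>)
open import Data.Product.Base using (_×_; _,_; proj₁; proj₂; ∃-syntax)
open import Data.Tree.Binary using (node)
open import Function.Base using (_∘_; flip; id)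
open import Function.Bundles using (_⇔_; mk⇔)
open import Function.Definitions using (Injective)
open import Relation.Binary.PropositionalEquality.Core
  using (_≡_; refl; sym; trans; cong; cong₂; subst)
open import Relation.Nullary.Decidable.Core using (yes; no)
open import Relation.Nullary.Negation.Core using (¬_; contradiction)
open import Defs

open IsRestriction

private
  variable
    a b c : Letter
    l r s s′ sl sr t t′ tL tR : BinTree
    P : Letter → Set

-- When the root exceeds `a`, the right subtree is dropped unexamined: in a right search tree its
-- labels are larger still.
below : Letter → BinTree → BinTree
below a empty = empty
below a (node l b r) with b ≤? a
... | yes _ = node (below a l) b (below a r)
... | no  _ = below a l

above : Letter → BinTree → BinTree
above a empty = empty
above a (node l b r) with b ≤? a
... | yes _ = above a r
... | no  _ = node (above a l) b (above a r)

rootInsertion : Letter → BinTree → BinTree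
rootInsertion a t = node (below a t) a (above a t)

-- Commutation of leaf insertion and root insertion

-- A discarded root `b > a` has `c ≤ b`, so `c` goes left, which is also where `below` continues.
-- The insertion path in `below a t` is thus the path in `t` without its discarded nodes.
below-leafInsert-≤ : ∀ t → c ≤ a →
                     below a (leafInsertRight c t) ≡ leafInsertRight c (below a t)
below-leafInsert-≤ {c} {a} empty c≤a with c ≤? a
... | yes _   = refl
... | no  c≰a = contradiction c≤a c≰a
-- If `b` is kept, the right-hand side tests `c ≤? b` once more; `eq` settles that second test.
below-leafInsert-≤ {c} {a} (node l b r) c≤a with c ≤? b in eq
... | yes c≤b with b ≤? a
...   | yes _ rewrite eq = cong (λ l → node l b _) (below-leafInsert-≤ l c≤a)
...   | no  _            = below-leafInsert-≤ l c≤a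
below-leafInsert-≤ {c} {a} (node l b r) c≤a | no c≰b with b ≤? a
...   | yes _ rewrite eq = cong (node _ b) (below-leafInsert-≤ r c≤a)
...   | no  b≰a          = contradiction (≤-trans c≤a (<⇒≤ (≰⇒> b≰a))) c≰b

-- The only change to `t` is a new leaf labelled `c`, which `below` either drops or never reaches.
below-leafInsert-> : ∀ t → c > a → below a (leafInsertRight c t) ≡ below a t
below-leafInsert-> {c} {a} empty c>a with c ≤? a
... | yes c≤a = contradiction c≤a (<⇒≱ c>a)
... | no  _   = refl
below-leafInsert-> {c} {a} (node l b r) c>a with c ≤? b
... | yes c≤b with b ≤? a
...   | yes b≤a = contradiction (≤-trans c≤b b≤a) (<⇒≱ c>a)
...   | no  _   = below-leafInsert-> l c>a
below-leafInsert-> {c} {a} (node l b r) c>a | no _ with b ≤? a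
...   | yes _ = cong (node _ b) (below-leafInsert-> r c>a)
...   | no  _ = refl

above-leafInsert-≤ : ∀ t → c ≤ a → above a (leafInsertRight c t) ≡ above a t
above-leafInsert-≤ {c} {a} empty c≤a with c ≤? a
... | yes _   = refl
... | no  c≰a = contradiction c≤a c≰a
above-leafInsert-≤ {c} {a} (node l b r) c≤a with c ≤? b
... | yes _ with b ≤? a
...   | yes _ = refl
...   | no  _ = cong (λ l → node l b _) (above-leafInsert-≤ l c≤a)
above-leafInsert-≤ {c} {a} (node l b r) c≤a | no c≰b with b ≤? a
...   | yes _   = above-leafInsert-≤ r c≤a
...   | no  b≰a = contradiction (≤-trans c≤a (<⇒≤ (≰⇒> b≰a))) c≰b

-- A discarded root `b ≤ a < c` sends `c` to the right, where `above` continues as well.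
above-leafInsert-> : ∀ t → c > a →
                     above a (leafInsertRight c t) ≡ leafInsertRight c (above a t)
above-leafInsert-> {c} {a} empty c>a with c ≤? a
... | yes c≤a = contradiction c≤a (<⇒≱ c>a)
... | no  _   = refl
above-leafInsert-> {c} {a} (node l b r) c>a with c ≤? b in eq
... | yes c≤b with b ≤? a
...   | yes b≤a          = contradiction (≤-trans c≤b b≤a) (<⇒≱ c>a)
...   | no  _ rewrite eq = cong (λ l → node l b _) (above-leafInsert-> l c>a)
above-leafInsert-> {c} {a} (node l b r) c>a | no _ with b ≤? a
...   | yes _            = above-leafInsert-> r c>a
...   | no  _ rewrite eq = cong (node _ b) (above-leafInsert-> r c>a)

-- The comparison of `c` with the new root `a` selects the half that receives `c`; the other half is
-- unaffected.
rootInsertion-leafInsertRight : ∀ a c t →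
  rootInsertion a (leafInsertRight c t) ≡ leafInsertRight c (rootInsertion a t)
rootInsertion-leafInsertRight a c t with c ≤? a
... | yes c≤a = cong₂ (λ l r → node l a r)
                      (below-leafInsert-≤ t c≤a) (above-leafInsert-≤ t c≤a)
... | no  c≰a = cong₂ (λ l r → node l a r)
                      (below-leafInsert-> t (≰⇒> c≰a)) (above-leafInsert-> t (≰⇒> c≰a))

rootInsertions : BinTree → Word → BinTree
rootInsertions = foldl (flip rootInsertion)

rootInsertions-leafInsertRight : ∀ c t u →
  rootInsertions (leafInsertRight c t) u ≡ leafInsertRight c (rootInsertions t u)
rootInsertions-leafInsertRight c t []      = refl
rootInsertions-leafInsertRight c t (a ∷ u) =
  trans (cong (λ t → rootInsertions t u) (rootInsertion-leafInsertRight a c t))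
        (rootInsertions-leafInsertRight c (rootInsertion a t) u)

-- Into the empty tree, root and leaf insertion of `a` give the same single node. The first letter
-- can therefore be leaf inserted, and that insertion postponed past all the others.
rootInsertions≡leafInsertions : ∀ u →
  rootInsertions empty u ≡ foldr leafInsertRight empty u
rootInsertions≡leafInsertions []      = refl
rootInsertions≡leafInsertions (a ∷ u) =
  trans (rootInsertions-leafInsertRight a empty u)
        (cong (leafInsertRight a) (rootInsertions≡leafInsertions u))

-- Restrictions of search trees

-- Models the inclusion of a subtree. Reflection of ancestry is what lets a restriction be pulled
-- back from the whole tree to the subtree.
record IsEmbedding (f : Node t → Node t′) : Set where
  field
    injective : Injective _≡_ _≡_ f
    label-≡   : ∀ x → label (f x) ≡ label x
    ancestor⁺ : ∀ {x y} → x IsAncestorOf y → f x IsAncestorOf f y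
    ancestor⁻ : ∀ {x y} → f x IsAncestorOf f y → x IsAncestorOf y

open IsEmbedding

inLeft-isEmbedding : IsEmbedding (Node.inLeft {l} {b} {r})
inLeft-isEmbedding = record
  { injective = λ { refl → refl }
  ; label-≡   = λ _ → refl
  ; ancestor⁺ = inLeft
  ; ancestor⁻ = λ { (inLeft p) → p }
  }

inRight-isEmbedding : IsEmbedding (Node.inRight {l} {b} {r})
inRight-isEmbedding = record
  { injective = λ { refl → refl }
  ; label-≡   = λ _ → refl
  ; ancestor⁺ = inRight
  ; ancestor⁻ = λ { (inRight p) → p }
  }

extend : {f : Node t → Node t′} → IsEmbedding f →
         (∀ y → P (label y) → ∃[ x ] f x ≡ y) →
         IsRestriction P t s → IsRestriction P t′ s
extend {P = P} {f = f} e cover R = record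
  { isRightBST      = isRightBST R
  ; origin          = f ∘ origin R
  ; origin-inj      = origin-inj R ∘ injective e
  ; origin-label    = λ x → trans (label-≡ e _) (origin-label R x)
  ; origin-sound    = λ x → subst P (sym (label-≡ e _)) (origin-sound R x)
  ; origin-complete = complete
  ; origin-ancestor = ancestor⁺ e ∘ origin-ancestor R
  }
  where
  complete : ∀ y → P (label y) → ∃[ x ] f (origin R x) ≡ y
  complete y Py with cover y Py
  ... | x , refl with origin-complete R x (subst P (label-≡ e x) Py)
  ...   | z , refl = z , refl

-- The new origin map is `origin R` after `g`, read back through `f`. With `g` the identity this
-- treats a dropped root; with `f` and `g` the inclusions of subtrees on the same side, a kept one.
corestrict : {f : Node t → Node t′} {g : Node s → Node s′} →
             IsEmbedding f → IsEmbedding g → IsRightBST s →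
             (R : IsRestriction P t′ s′) →
             (∀ x → ∃[ y ] f y ≡ origin R (g x)) →
             (∀ y → P (label (f y)) → ∃[ x ] origin R (g x) ≡ f y) →
             IsRestriction P t s
corestrict {P = P} {f = f} {g} e d bst R image complete = record
  { isRightBST      = bst
  ; origin          = o
  ; origin-inj      = λ {x} {y} eq → injective d (origin-inj R
      (trans (sym (f-o x)) (trans (cong f eq) (f-o y))))
  ; origin-label    = o-label
  ; origin-sound    = λ x → subst P (trans (cong label (sym (f-o x))) (label-≡ e _))
                                    (origin-sound R (g x))
  ; origin-complete = complete′
  ; origin-ancestor = λ {x} {y} p → ancestor⁻ e
      (subst (_IsAncestorOf f (o y)) (sym (f-o x))
        (subst (origin R (g x) IsAncestorOf_) (sym (f-o y))
          (origin-ancestor R (ancestor⁺ d p))))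
  }
  where
  o = λ x → proj₁ (image x)

  f-o : ∀ x → f (o x) ≡ origin R (g x)
  f-o x = proj₂ (image x)

  o-label : ∀ x → label (o x) ≡ label x
  o-label x = trans (sym (label-≡ e _)) (trans (cong label (f-o x))
                (trans (origin-label R (g x)) (label-≡ d x)))

  complete′ : ∀ y → P (label y) → ∃[ x ] o x ≡ y
  complete′ y Py with complete y (subst P (sym (label-≡ e y)) Py)
  ... | x , eq = x , injective e (trans (f-o x) eq)

id-isEmbedding : IsEmbedding (id {A = Node t})
id-isEmbedding = record
  { injective = id ; label-≡ = λ _ → refl ; ancestor⁺ = id ; ancestor⁻ = id }

extend⁻¹ : {f : Node t → Node t′} → IsEmbedding f →
           (∀ y → P (label y) → ∃[ x ] f x ≡ y) →
           IsRestriction P t′ s → IsRestriction P t s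
extend⁻¹ {f = f} e cover R =
  corestrict e id-isEmbedding (isRightBST R) R
    (λ x → cover _ (origin-sound R x)) (λ y → origin-complete R (f y))

empty-restriction : IsRestriction P empty empty
empty-restriction = record
  { isRightBST      = leaf
  ; origin          = λ ()
  ; origin-inj      = λ { {()} }
  ; origin-label    = λ ()
  ; origin-sound    = λ ()
  ; origin-complete = λ ()
  ; origin-ancestor = λ { {()} }
  }

empty-restriction⁻¹ : IsRestriction P empty s → s ≡ empty
empty-restriction⁻¹ {s = empty}      R = refl
empty-restriction⁻¹ {s = node l b r} R with () ← origin R root

keepRoot : IsRightBST (node l b r) → P b →
           IsRestriction P l sl → IsRestriction P r sr →
           IsRestriction P (node l b r) (node sl b sr)
keepRoot {l} {b} {r} {P} {sl} {sr} (node l≤b b<r _ _) Pb L R = record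
  { isRightBST      = node
      (λ x → subst (_≤ b) (origin-label L x) (l≤b (origin L x)))
      (λ x → subst (b <_) (origin-label R x) (b<r (origin R x)))
      (isRightBST L) (isRightBST R)
  ; origin          = o
  ; origin-inj      = o-inj
  ; origin-label    = λ { root        → refl
                        ; (inLeft x)  → origin-label L x
                        ; (inRight x) → origin-label R x }
  ; origin-sound    = λ { root        → Pb
                        ; (inLeft x)  → origin-sound L x
                        ; (inRight x) → origin-sound R x }
  ; origin-complete = complete
  ; origin-ancestor = λ { root-left   → root-left
                        ; root-right  → root-right
                        ; (inLeft p)  → inLeft (origin-ancestor L p)
                        ; (inRight p) → inRight (origin-ancestor R p) }
  }
  where
  o : Node (node sl b sr) → Node (node l b r)
  o root        = root
  o (inLeft x)  = inLeft (origin L x)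
  o (inRight x) = inRight (origin R x)

  o-inj : Injective _≡_ _≡_ o
  o-inj {root}      {root}      _  = refl
  o-inj {inLeft x}  {inLeft y}  eq =
    cong inLeft (origin-inj L (injective inLeft-isEmbedding eq))
  o-inj {inRight x} {inRight y} eq =
    cong inRight (origin-inj R (injective inRight-isEmbedding eq))

  complete : ∀ y → P (label y) → ∃[ x ] o x ≡ y
  complete root        _  = root , refl
  complete (inLeft y)  Py with origin-complete L y Py
  ... | x , refl = inLeft x , refl
  complete (inRight y) Py with origin-complete R y Py
  ... | x , refl = inRight x , refl

root-minimal : {x : Node (node l b r)} → ¬ (x IsAncestorOf root)
root-minimal ()

-- If the root of the large tree came from a node below the root of the small one, the origin of the
-- small root would be a proper ancestor of the large root.
origin-root : (R : IsRestriction P (node l b r) (node sl c sr)) → P b →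
              origin R root ≡ root
origin-root R Pb with origin-complete R root Pb
... | root      , eq = eq
... | inLeft x  , eq =
  ⊥-elim (root-minimal (subst (origin R root IsAncestorOf_) eq (origin-ancestor R root-left)))
... | inRight x , eq =
  ⊥-elim (root-minimal (subst (origin R root IsAncestorOf_) eq (origin-ancestor R root-right)))

keepRoot⁻¹ : IsRightBST (node l b r) → P b → IsRestriction P (node l b r) s →
             ∃[ sl ] ∃[ sr ] s ≡ node sl b sr ×
               IsRestriction P l sl × IsRestriction P r sr
keepRoot⁻¹ {s = empty} _ Pb R with () ← proj₁ (origin-complete R root Pb)
keepRoot⁻¹ {l} {b} {r} {P} {node sl c sr} (node l≤b b<r _ _) Pb R
  -- Both roots carry the same label, so the search order of the small tree is also relative to `b`.
  with trans (sym (origin-label R root)) (cong label (origin-root R Pb)) | isRightBST R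
... | refl | node sl≤b b<sr bstl bstr =
  sl , sr , refl ,
  corestrict inLeft-isEmbedding inLeft-isEmbedding bstl R imageL completeL ,
  corestrict inRight-isEmbedding inRight-isEmbedding bstr R imageR completeR
  where
  o-root = origin-root R Pb

  -- Injectivity keeps the origin away from the root, which is already taken, and its label, at most
  -- `b`, keeps it out of the right subtree.
  imageL : ∀ x → ∃[ y ] inLeft y ≡ origin R (inLeft x)
  imageL x with origin R (inLeft x) in eq | origin-label R (inLeft x)
  ... | root      | _  with () ← origin-inj R (trans eq (sym o-root))
  ... | inLeft y  | _  = y , refl
  ... | inRight y | eq′ = contradiction (subst (_≤ b) (sym eq′) (sl≤b x)) (<⇒≱ (b<r y))

  imageR : ∀ x → ∃[ y ] inRight y ≡ origin R (inRight x)
  imageR x with origin R (inRight x) in eq | origin-label R (inRight x)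
  ... | root      | _   with () ← origin-inj R (trans eq (sym o-root))
  ... | inLeft y  | eq′ = contradiction (l≤b y) (<⇒≱ (subst (b <_) (sym eq′) (b<sr x)))
  ... | inRight y | _   = y , refl

  -- The preimage of a left node is a left node, since the root and the right nodes have their
  -- origins at the root and on the right.
  completeL : ∀ y → P (label y) → ∃[ x ] origin R (inLeft x) ≡ inLeft y
  completeL y Py with origin-complete R (inLeft y) Py
  ... | root      , eq with () ← trans (sym o-root) eq
  ... | inLeft x  , eq = x , eq
  ... | inRight x , eq with () ← trans (proj₂ (imageR x)) eq

  completeR : ∀ y → P (label y) → ∃[ x ] origin R (inRight x) ≡ inRight y
  completeR y Py with origin-complete R (inRight y) Py
  ... | root      , eq with () ← trans (sym o-root) eq
  ... | inLeft x  , eq with () ← trans (proj₂ (imageL x)) eq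
  ... | inRight x , eq = x , eq

-- Restrictions that drop the root

inLeft-cover : ¬ P b → (∀ (y : Node r) → ¬ P (label y)) →
               ∀ y → P (label y) → ∃[ x ] Node.inLeft {l} {b} {r} x ≡ y
inLeft-cover ¬Pb ¬Pr root        Py = contradiction Py ¬Pb
inLeft-cover ¬Pb ¬Pr (inLeft y)  Py = y , refl
inLeft-cover ¬Pb ¬Pr (inRight y) Py = contradiction Py (¬Pr y)

inRight-cover : ¬ P b → (∀ (y : Node l) → ¬ P (label y)) →
                ∀ y → P (label y) → ∃[ x ] Node.inRight {l} {b} {r} x ≡ y
inRight-cover ¬Pb ¬Pl root        Py = contradiction Py ¬Pb
inRight-cover ¬Pb ¬Pl (inLeft y)  Py = contradiction Py (¬Pl y)
inRight-cover ¬Pb ¬Pl (inRight y) Py = y , refl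

≰-cover : IsRightBST (node l b r) → ¬ b ≤ a →
          ∀ y → label y ≤ a → ∃[ x ] Node.inLeft {l} {b} {r} x ≡ y
≰-cover {a = a} (node _ b<r _ _) b≰a =
  inLeft-cover {P = _≤ a} b≰a (λ y y≤a → b≰a (≤-trans (<⇒≤ (b<r y)) y≤a))

≤-cover : IsRightBST (node l b r) → b ≤ a →
          ∀ y → label y > a → ∃[ x ] Node.inRight {l} {b} {r} x ≡ y
≤-cover {a = a} (node l≤b _ _ _) b≤a =
  inRight-cover {P = _> a} (λ b>a → <⇒≱ b>a b≤a)
    (λ y y>a → <⇒≱ y>a (≤-trans (l≤b y) b≤a))

-- Existence and uniqueness of the two halves

below-restriction : IsRightBST t → IsRestriction (_≤ a) t (below a t)
below-restriction leaf = empty-restriction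
below-restriction {node l b r} {a} bst@(node _ _ bstl bstr) with b ≤? a
... | yes b≤a = keepRoot bst b≤a (below-restriction bstl) (below-restriction bstr)
... | no  b≰a = extend inLeft-isEmbedding (≰-cover bst b≰a) (below-restriction bstl)

above-restriction : IsRightBST t → IsRestriction (_> a) t (above a t)
above-restriction leaf = empty-restriction
above-restriction {node l b r} {a} bst@(node _ _ bstl bstr) with b ≤? a
... | yes b≤a = extend inRight-isEmbedding (≤-cover bst b≤a) (above-restriction bstr)
... | no  b≰a =
  keepRoot bst (≰⇒> b≰a) (above-restriction bstl) (above-restriction bstr)

below-unique : IsRightBST t → IsRestriction (_≤ a) t s → s ≡ below a t
below-unique leaf R = empty-restriction⁻¹ R
below-unique {node l b r} {a} bst@(node _ _ bstl bstr) R with b ≤? a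
... | no  b≰a =
  below-unique bstl (extend⁻¹ inLeft-isEmbedding (≰-cover bst b≰a) R)
... | yes b≤a with keepRoot⁻¹ bst b≤a R
...   | _ , _ , refl , L , R′ =
  cong₂ (λ l r → node l b r) (below-unique bstl L) (below-unique bstr R′)

above-unique : IsRightBST t → IsRestriction (_> a) t s → s ≡ above a t
above-unique leaf R = empty-restriction⁻¹ R
above-unique {node l b r} {a} bst@(node _ _ bstl bstr) R with b ≤? a
... | yes b≤a =
  above-unique bstr (extend⁻¹ inRight-isEmbedding (≤-cover bst b≤a) R)
... | no  b≰a with keepRoot⁻¹ bst (≰⇒> b≰a) R
...   | _ , _ , refl , L , R′ =
  cong₂ (λ l r → node l b r) (above-unique bstl L) (above-unique bstr R′)

-- The iterative symbol

rootInsertion-sound : IsRightBST t → RootInsert a t (rootInsertion a t)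
rootInsertion-sound bst = rootInsert (below-restriction bst) (above-restriction bst)

rootInsertion-unique : IsRightBST t → RootInsert a t t′ → t′ ≡ rootInsertion a t
rootInsertion-unique bst (rootInsert B A) =
  cong₂ (λ l r → node l _ r) (below-unique bst B) (above-unique bst A)

-- The invariant that lets existence and uniqueness be applied again at the next letter.
rootInsertion-isRightBST : IsRightBST t → IsRightBST (rootInsertion a t)
rootInsertion-isRightBST {a = a} bst = node
  (λ x → subst (_≤ a) (origin-label B x) (origin-sound B x))
  (λ x → subst (_> a) (origin-label A x) (origin-sound A x))
  (isRightBST B) (isRightBST A)
  where
  B = below-restriction bst
  A = above-restriction bst

insertions : BinTree × BinTree → Word → BinTree × BinTree
insertions (tL , tR) u = foldl (λ t a → leafInsertLeft a t) tL u , rootInsertions tR u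

insertions-sound : ∀ u → IsRightBST tR →
                   InsertWord u (tL , tR) (insertions (tL , tR) u)
insertions-sound []      bst = []
insertions-sound (a ∷ u) bst =
  insert (rootInsertion-sound bst) ∷ insertions-sound u (rootInsertion-isRightBST bst)

insertions-unique : ∀ {u p} → IsRightBST tR → InsertWord u (tL , tR) p →
                    insertions (tL , tR) u ≡ p
insertions-unique bst []             = refl
insertions-unique bst (insert i ∷ w) with rootInsertion-unique bst i
... | refl = insertions-unique (rootInsertion-isRightBST bst) w

insertions≡baxterP : ∀ u → insertions (empty , empty) u ≡ baxterP u
insertions≡baxterP u =
  cong (foldl (λ t a → leafInsertLeft a t) empty u ,_) (rootInsertions≡leafInsertions u)

-- As the iterative symbol is a relation, equality of the two symbols means that it relates `u` to
-- the pair `baxterP u` and to no other: uniqueness gives the forward direction, existence the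
-- backward one.
proposition4p19 : (u : Word) (p : BinTree × BinTree) →
    IsIterativeBaxterP u p ⇔ baxterP u ≡ p
proposition4p19 u p = mk⇔
  (λ w → trans (sym (insertions≡baxterP u)) (insertions-unique leaf w))
  (λ { refl → subst (InsertWord u _) (insertions≡baxterP u) (insertions-sound u leaf) })
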